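{- Let $\mathbf{u}$ be an infinite word over a ternary alphabet $\mathcal{A}$ whose language $\mathcal{L}(\mathbf{u})$ is closed under reversal. If the complexity of $\mathbf{u}$ satisfies $\mathcal{C}(n)=2n+1$ for every $n\in\mathbb{N}$ and $\mathbf{u}$ has no maximal left special factor, then $\mathbf{u}$ has the property $\mathcal{PE}$: for every palindrome $p\in\mathcal{L}(\mathbf{u})$ there exists exactly one letter $a\in\mathcal{A}$ such that $apa\in\mathcal{L}(\mathbf{u})$.
   Context: $\mathbb{N}$ includes $0$. The language $\mathcal{L}(\mathbf{u})$ is the set of all finite factors of $\mathbf{u}$ (including the empty word); $\mathcal{L}_n(\mathbf{u})$ is the set of factors of length $n$ and $\mathcal{C}(n)=\#\mathcal{L}_n(\mathbf{u})$. The reversal of $w=w_0\cdots w_{n-1}$ is $\overline{w}=w_{n-1}\cdots w_0$; a palindrome satisfies $w=\overline{w}$; the language is closed under reversal if $w\in\mathcal{L}(\mathbf{u})\Rightarrow\overline{w}\in\mathcal{L}(\mathbf{u})$. A factor $w$ is left special if there are two distinct letters $a,b$ with $aw,bw\in\mathcal{L}(\mathbf{u})$. A left special factor $w$ is maximal if for no letter $c\in\mathcal{A}$ is $wc$ left special. -}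

module Defs where

open import Data.Nat using (ℕ; _+_; _*_; suc)
open import Data.Fin using (Fin; toℕ)
open import Data.List using (List; []; _∷_; _++_; [_]; length; tabulate; reverse)
open import Data.List.Membership.Propositional using (_∈_)
open import Data.List.Relation.Unary.Unique.Propositional using (Unique)
open import Data.Product using (Σ; ∃; _×_; _,_)
open import Relation.Binary.PropositionalEquality using (_≡_; _≢_)
open import Relation.Nullary using (¬_)

Letter : Set
Letter = Fin 3

InfWord : Set
InfWord = ℕ → Letter

Word : Set
Word = List Letter

slice : InfWord → ℕ → ℕ → Word
slice u i n = tabulate {n = n} (λ j → u (i + toℕ j))

Factor : InfWord → Word → Set
Factor u w = ∃ λ i → slice u i (length w) ≡ w

ComplexityIs : InfWord → ℕ → ℕ → Set
ComplexityIs u n k =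
  Σ (List Word) λ ws →
    Unique ws × length ws ≡ k ×
    (∀ w → w ∈ ws → Factor u w × length w ≡ n) ×
    (∀ w → Factor u w → length w ≡ n → w ∈ ws)

ClosedUnderReversal : InfWord → Set
ClosedUnderReversal u = ∀ w → Factor u w → Factor u (reverse w)

Palindrome : Word → Set
Palindrome w = reverse w ≡ w

LeftSpecial : InfWord → Word → Set
LeftSpecial u w = Σ Letter λ a → Σ Letter λ b → a ≢ b × Factor u (a ∷ w) × Factor u (b ∷ w)

MaximalLeftSpecial : InfWord → Word → Set
MaximalLeftSpecial u w = LeftSpecial u w × (∀ c → ¬ LeftSpecial u (w ++ [ c ]))

PE : InfWord → Set
PE u = ∀ p → Factor u p → Palindrome p →
  Σ Letter λ a → Factor u (a ∷ p ++ [ a ]) × (∀ b → Factor u (b ∷ p ++ [ b ]) → b ≡ a)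

{-# OPTIONS --safe #-}
module Submission where

-- Since C(n+1) - C(n) = 2 and left special factors extend to the right, at each length there are either
-- two left special factors with two left extensions each, or a single one with three. A palindrome p
-- with at most two left extensions is handled by this count alone. If p has three, then the symmetric
-- relation { (x, y) : x p y is a factor } on the letters has exactly five elements, hence one or three
-- diagonal ones; in the latter case one letter c only occurs as c p c. This is excluded by descent on p:
-- the first letter s of p separates all other letters, so the language is obtained by x ↦ s x (x ≢ s),
-- s ↦ s from a language in which a shorter palindrome has the same defect. For the empty
-- palindrome the defect says that c is adjacent to no other letter, contradicting recurrence.

open import Defs
open import Data.Bool using (Bool; true; false)
import Data.Bool as Bool
open import Data.Empty using (⊥; ⊥-elim)
open import Data.Fin using (_≟_; toℕ)
open import Data.Fin.Patterns using (0F; 1F; 2F)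
open import Data.Fin.Properties using (all?; any?; ¬∀⟶∃¬)
open import Data.List using (List; []; _∷_; _++_; [_]; length; reverse; map; concatMap; filter; take; drop; allFin; cartesianProduct; initLast; _∷ʳ′_)
import Data.List.Membership.DecPropositional as DecMembership
open import Data.List.Membership.Propositional using (_∈_)
open import Data.List.Membership.Propositional.Properties
open import Data.List.Membership.Propositional.Properties.WithK using (unique∧set⇒bag)
open import Data.List.Properties
open import Data.List.Relation.Binary.BagAndSetEquality using (∼bag⇒↭)
open import Data.List.Relation.Binary.Permutation.Propositional.Properties using (↭-length)
open import Data.List.Relation.Unary.All using (_∷_)
open import Data.List.Relation.Unary.AllPairs using (_∷_)
open import Data.List.Relation.Unary.Any using (here; there)
open import Data.List.Relation.Unary.Unique.Propositional using (Unique)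
import Data.List.Relation.Unary.Unique.Propositional.Properties as Unique
open import Data.Nat using (ℕ; zero; suc; _+_; _*_; _≤_; s≤s)
import Data.Nat as ℕ
import Data.Nat.Properties as ℕₚ
open import Data.Product using (∃; _×_; _,_; proj₁; proj₂)
open import Data.Sum using (_⊎_; inj₁; inj₂; [_,_]′)
open import Function using (_∘_; mk⇔)
open import Relation.Binary.PropositionalEquality hiding ([_])
open import Relation.Nullary using (¬_; Dec; yes; no; does; ¬?; map′; _→-dec_; _×-dec_; _⊎-dec_)
open import Relation.Nullary.Decidable using (decidable-stable; dec-true; does-⇔; from-yes)
open import Relation.Unary using (Decidable)

-- Recurrent languages closed under factors and reversal

-- The descent passes to languages that are not presented by an infinite word, so only closure
-- properties that survive desubstitution are kept.
record Language : Set₁ where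
  field
    Fac       : Word → Set
    factorial : ∀ x w y → Fac (x ++ w ++ y) → Fac w
    recurrent : ∀ {x y} → Fac x → Fac y → ∃ λ v → Fac (x ++ v ++ y)
    reversal  : ∀ {w} → Fac w → Fac (reverse w)

  suffix : ∀ x {w} → Fac (x ++ w) → Fac w
  suffix x {w} f = factorial x w [] (subst (λ v → Fac (x ++ v)) (sym (++-identityʳ w)) f)

  prefix : ∀ w {y} → Fac (w ++ y) → Fac w
  prefix w {y} = factorial [] w y

  reversal-++ : ∀ x {y} → Fac (x ++ y) → Fac (reverse y ++ reverse x)
  reversal-++ x {y} = subst Fac (reverse-++ x y) ∘ reversal

  last-letter : ∀ z v {w} → Fac (z ∷ v ++ w) → ∃ λ y → Fac (y ∷ w)
  last-letter z []      f = z , f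
  last-letter z (y ∷ v) f = last-letter y v (suffix [ z ] f)

  -- `recurrent` yields a factor `z v w`, and its letter just before `w` serves.
  extendˡ : ∀ {z w} → Fac [ z ] → Fac w → ∃ λ y → Fac (y ∷ w)
  extendˡ {z} fz fw with v , f ← recurrent fz fw = last-letter z v f

  extendʳ : ∀ {z w} → Fac [ z ] → Fac w → ∃ λ y → Fac (w ++ [ y ])
  extendʳ {w = w} fz fw with y , f ← extendˡ fz (reversal fw) =
    y , subst (λ v → Fac (v ++ [ y ])) (reverse-involutive w) (reversal-++ [ y ] f)

  LeftSpecialIn : Word → Set
  LeftSpecialIn w = ∃ λ a → ∃ λ b → a ≢ b × Fac (a ∷ w) × Fac (b ∷ w)

  -- A set of letters closed under taking the preceding letter cannot be entered from outside.
  predecessor-closed : (S : Letter → Set) → (∀ {x y} → Fac (x ∷ y ∷ []) → S y → S x) →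
    ∀ x v {z} → Fac (x ∷ v ++ [ z ]) → S z → S x
  predecessor-closed S closed x []      f sz = closed f sz
  predecessor-closed S closed x (y ∷ v) f sz =
    closed (prefix (x ∷ y ∷ []) f) (predecessor-closed S closed y v (suffix [ x ] f) sz)

-- Prefixes and the substitution x ↦ s x (x ≢ s), s ↦ s

_≼_ : Word → Word → Set
x ≼ y = ∃ λ t → x ++ t ≡ y

module Substitution (s : Letter) where

  block : Letter → Word
  block x with x ≟ s
  ... | yes _ = s ∷ []
  ... | no  _ = s ∷ x ∷ []

  ψ : Word → Word
  ψ = concatMap block

  -- The trailing s makes decoding unambiguous and the image of a palindrome a palindrome.
  Ψ : Word → Word
  Ψ w = ψ w ++ [ s ]

  block-s : block s ≡ s ∷ []
  block-s with s ≟ s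
  ... | yes _  = refl
  ... | no s≢s = ⊥-elim (s≢s refl)

  block-≢ : ∀ {x} → x ≢ s → block x ≡ s ∷ x ∷ []
  block-≢ {x} x≢s with x ≟ s
  ... | yes x≡s = ⊥-elim (x≢s x≡s)
  ... | no  _   = refl

  block-last : ∀ x → ∃ λ t → block x ≡ t ++ [ x ]
  block-last x with x ≟ s
  ... | yes refl = [] , refl
  ... | no  _    = [ s ] , refl

  Ψ-++ : ∀ x y → Ψ (x ++ y) ≡ ψ x ++ Ψ y
  Ψ-++ x y = trans (cong (_++ [ s ]) (concatMap-++ block x y)) (++-assoc (ψ x) (ψ y) [ s ])

  Ψ-∷ : ∀ x w → Ψ (x ∷ w) ≡ block x ++ Ψ w
  Ψ-∷ x w = ++-assoc (block x) (ψ w) [ s ]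

  Ψ-head : ∀ w → ∃ λ t → Ψ w ≡ s ∷ t
  Ψ-head []      = [] , refl
  Ψ-head (x ∷ w) with x ≟ s
  ... | yes _ = Ψ w , refl
  ... | no  _ = x ∷ Ψ w , refl

  -- Lets the trailing `s` of `Ψ` move across a reversed block; `reverse-Ψ` uses this once per
  -- letter.
  reverse-block : ∀ x → [ s ] ++ reverse (block x) ≡ block x ++ [ s ]
  reverse-block x with x ≟ s
  ... | yes _ = refl
  ... | no  _ = refl

  reverse-Ψ : ∀ w → reverse (Ψ w) ≡ Ψ (reverse w)
  reverse-Ψ []      = refl
  reverse-Ψ (x ∷ w) = begin
    reverse (Ψ (x ∷ w))                              ≡⟨ cong reverse (Ψ-∷ x w) ⟩
    reverse (block x ++ Ψ w)                         ≡⟨ reverse-++ (block x) (Ψ w) ⟩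
    reverse (Ψ w) ++ reverse (block x)               ≡⟨ cong (_++ reverse (block x)) (reverse-Ψ w) ⟩
    Ψ (reverse w) ++ reverse (block x)               ≡⟨ ++-assoc (ψ (reverse w)) [ s ] _ ⟩
    ψ (reverse w) ++ ([ s ] ++ reverse (block x))    ≡⟨ cong (ψ (reverse w) ++_) (reverse-block x) ⟩
    ψ (reverse w) ++ (block x ++ [ s ])              ≡⟨ cong (λ b → ψ (reverse w) ++ (b ++ [ s ])) (++-identityʳ (block x)) ⟨
    ψ (reverse w) ++ Ψ [ x ]                         ≡⟨ Ψ-++ (reverse w) [ x ] ⟨
    Ψ (reverse w ++ [ x ])                           ≡⟨ cong Ψ (unfold-reverse x w) ⟨
    Ψ (reverse (x ∷ w))                              ∎
    where open ≡-Reasoning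

  -- s followed by x ≢ s decodes to a block of x, so the two kinds of block are told apart by the next letter.
  Ψ-prefix : ∀ w v → Ψ w ≼ Ψ v → w ≼ v
  Ψ-prefix []      v       _ = v , refl
  Ψ-prefix (x ∷ w) []      (t , eq) with x ≟ s | Ψ-head w
  ... | yes _ | h , e with () ← trans (cong (λ q → s ∷ (q ++ t)) (sym e)) eq
  ... | no  _ | h , e with () ← eq
  Ψ-prefix (x ∷ w) (y ∷ v) (t , eq) with x ≟ s | y ≟ s
  ... | yes refl | yes refl with r , e ← Ψ-prefix w v (t , ∷-injectiveʳ eq) = r , cong (s ∷_) e
  ... | yes refl | no y≢s with h , e ← Ψ-head w =
    ⊥-elim (y≢s (sym (∷-injectiveˡ (trans (cong (_++ t) (sym e)) (∷-injectiveʳ eq)))))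
  ... | no x≢s | yes refl with h , e ← Ψ-head v =
    ⊥-elim (x≢s (∷-injectiveˡ (trans (∷-injectiveʳ eq) e)))
  ... | no _ | no _ with ∷-injective (∷-injectiveʳ eq)
  ...   | refl , eq′ with r , e ← Ψ-prefix w v (t , eq′) = r , cong (x ∷_) e

  Ψ-injective : ∀ w v → Ψ w ≡ Ψ v → w ≡ v
  Ψ-injective w v eq
    with t , refl ← Ψ-prefix w v ([] , trans (++-identityʳ (Ψ w)) eq)
    with r , e ← Ψ-prefix (w ++ t) w ([] , trans (++-identityʳ _) (sym eq)) =
    -- Here `w ++ t ++ r` equals `w`, so `t` is empty.
    sym (trans (cong (w ++_) (++-conicalˡ t r (++-identityʳ-unique w (sym (trans (sym (++-assoc w t r)) e))))) (++-identityʳ w))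

  -- Makes the descent terminate: `Ψ t` has one letter more than `ψ t`, hence is strictly longer
  -- than `t`.
  length-ψ : ∀ w → length w ≤ length (ψ w)
  length-ψ []      = ℕₚ.≤-refl
  length-ψ (x ∷ w) with x ≟ s
  ... | yes _ = s≤s (length-ψ w)
  ... | no  _ = s≤s (ℕₚ.m≤n⇒m≤1+n (length-ψ w))

-- Desubstitution when every factor of length two contains `s`

module Desubstitution (𝓛 : Language) (s : Letter)
  (separates : ∀ {x y} → Language.Fac 𝓛 (x ∷ y ∷ []) → x ≡ s ⊎ y ≡ s) where

  open Language 𝓛
  open Substitution s

  -- Blocks are read from the left. An `s` that is last in `s ∷ v` or followed by `s` is a block by
  -- itself. An `s` followed by `x ≢ s` opens the block of `x`, and by `separates` any next letter
  -- is again `s`.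
  decode : ∀ v → Fac (s ∷ v ++ [ s ]) → ∃ λ t → s ∷ v ≡ ψ t
  decode [] f = [ s ] , sym (cong (_++ []) block-s)
  decode (x ∷ v) f with x ≟ s
  ... | yes refl with t , e ← decode v (suffix [ s ] f) =
    s ∷ t , trans (cong (s ∷_) e) (cong (_++ ψ t) (sym block-s))
  decode (x ∷ []) f | no x≢s = [ x ] , sym (cong (_++ []) (block-≢ x≢s))
  decode (x ∷ y ∷ v) f | no x≢s with separates (factorial [ s ] (x ∷ y ∷ []) (v ++ [ s ]) f)
  ... | inj₁ x≡s  = ⊥-elim (x≢s x≡s)
  ... | inj₂ refl with t , e ← decode v (suffix (s ∷ x ∷ []) f) =
    x ∷ t , trans (cong (λ w → s ∷ x ∷ w) e) (cong (_++ ψ t) (sym (block-≢ x≢s)))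

  -- A palindrome starting with `s` also ends with `s`, which provides the trailing `s` of `Ψ`; the
  -- single letter `s` is `Ψ []`.
  decode-palindrome : ∀ {q} → Palindrome (s ∷ q) → Fac (s ∷ q) → ∃ λ t → s ∷ q ≡ Ψ t
  decode-palindrome {q} pal f with reverse q | trans (sym (unfold-reverse s q)) pal
  ... | []    | e = [] , sym e
  ... | y ∷ v | e with refl ← ∷-injectiveˡ e
                  with t , e′ ← decode v (subst Fac (sym e) f) = t , trans (sym e) (cong (_++ [ s ]) e′)

  private
    FacΨ : Word → Set
    FacΨ w = Fac (Ψ w)

    -- Inside `Ψ (x ++ w ++ y)` the trailing `s` of `Ψ w` is the first letter of `Ψ y`.
    factorialΨ : ∀ x w y → FacΨ (x ++ w ++ y) → FacΨ w
    factorialΨ x w y f with h , e ← Ψ-head y =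
      factorial (ψ x) (Ψ w) h (subst Fac eq f)
      where
      open ≡-Reasoning
      eq : Ψ (x ++ w ++ y) ≡ ψ x ++ Ψ w ++ h
      eq = begin
        Ψ (x ++ w ++ y)         ≡⟨ Ψ-++ x (w ++ y) ⟩
        ψ x ++ Ψ (w ++ y)       ≡⟨ cong (ψ x ++_) (Ψ-++ w y) ⟩
        ψ x ++ ψ w ++ Ψ y       ≡⟨ cong (λ q → ψ x ++ ψ w ++ q) e ⟩
        ψ x ++ ψ w ++ s ∷ h     ≡⟨ cong (ψ x ++_) (++-assoc (ψ w) [ s ] h) ⟨
        ψ x ++ Ψ w ++ h         ∎

    recurrentΨ : ∀ {x y} → FacΨ x → FacΨ y → ∃ λ v → FacΨ (x ++ v ++ y)
    recurrentΨ {x} {y} fx fy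
      with v , f ← recurrent fx fy | h , e ← Ψ-head y
      -- The stretch from the trailing `s` of `Ψ x` to the first `s` of `Ψ y` can be decoded.
      with t , eq ← decode v (factorial (ψ x) (s ∷ v ++ [ s ]) h (subst Fac (trans (++-assoc (ψ x) [ s ] _)
                       (cong (λ q → ψ x ++ s ∷ q) (trans (cong (v ++_) e) (sym (++-assoc v [ s ] h))))) f)) =
      t , subst Fac (begin
        Ψ x ++ v ++ Ψ y         ≡⟨ ++-assoc (ψ x) [ s ] _ ⟩
        ψ x ++ (s ∷ v) ++ Ψ y   ≡⟨ cong (λ q → ψ x ++ q ++ Ψ y) eq ⟩
        ψ x ++ ψ t ++ Ψ y       ≡⟨ cong (ψ x ++_) (Ψ-++ t y) ⟨
        ψ x ++ Ψ (t ++ y)       ≡⟨ Ψ-++ x (t ++ y) ⟨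
        Ψ (x ++ t ++ y)         ∎) f
      where open ≡-Reasoning

  desubstituted : Language
  desubstituted = record
    { Fac       = FacΨ
    ; factorial = factorialΨ
    ; recurrent = λ {x} {y} → recurrentΨ {x} {y}
    ; reversal  = λ {w} f → subst Fac (reverse-Ψ w) (reversal f)
    }

  private
    Ψ-sandwich : ∀ x w y → Ψ (x ∷ w ++ [ y ]) ≡ block x ++ ψ w ++ block y ++ [ s ]
    Ψ-sandwich x w y = trans (Ψ-∷ x (w ++ [ y ])) (cong (block x ++_)
      (trans (Ψ-++ w [ y ]) (cong (λ q → ψ w ++ q ++ [ s ]) (++-identityʳ (block y)))))

    block-head : ∀ y → ∃ λ t → block y ++ [ s ] ≡ s ∷ y ∷ t
    block-head y with y ≟ s
    ... | yes refl = [] , refl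
    ... | no  _    = [ s ] , refl

  unblock : ∀ x w → Fac (Ψ (x ∷ w)) → Fac (x ∷ Ψ w)
  unblock x w f with t , e ← block-last x =
    suffix t (subst Fac (trans (Ψ-∷ x w) (trans (cong (_++ Ψ w) e) (++-assoc t [ x ] (Ψ w)))) f)

  -- The first `s` after `ψ w` is the trailing `s` of `Ψ w`, and the letter after it is `y`, also
  -- when `y` is `s`.
  unblock² : ∀ x w y → Fac (Ψ (x ∷ w ++ [ y ])) → Fac (x ∷ Ψ w ++ [ y ])
  unblock² x w y f with t , e ← block-head y =
    prefix (x ∷ Ψ w ++ [ y ]) (subst Fac eq (unblock x (w ++ [ y ]) f))
    where
    open ≡-Reasoning
    eq : x ∷ Ψ (w ++ [ y ]) ≡ (x ∷ Ψ w ++ [ y ]) ++ t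
    eq = cong (x ∷_) (begin
      Ψ (w ++ [ y ])              ≡⟨ Ψ-++ w [ y ] ⟩
      ψ w ++ Ψ [ y ]              ≡⟨ cong (λ q → ψ w ++ q ++ [ s ]) (++-identityʳ (block y)) ⟩
      ψ w ++ block y ++ [ s ]     ≡⟨ cong (ψ w ++_) e ⟩
      ψ w ++ s ∷ y ∷ t            ≡⟨ ++-assoc (ψ w) [ s ] (y ∷ t) ⟨
      Ψ w ++ y ∷ t                ≡⟨ ++-assoc (Ψ w) [ y ] t ⟨
      (Ψ w ++ [ y ]) ++ t         ∎)

  -- If `x ≢ s`, then by `separates` the word extends by `s` on both sides, which completes the two
  -- outer blocks. If `x ≡ s`, it is already an encoded word.
  block² : ∀ x w → Fac (x ∷ Ψ w ++ [ x ]) → Fac (Ψ (x ∷ w ++ [ x ]))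
  block² x w f = by-cases (x ≟ s)
    where
    open ≡-Reasoning

    by-cases : Dec (x ≡ s) → Fac (Ψ (x ∷ w ++ [ x ]))
    by-cases (yes refl) = subst Fac (begin
      x ∷ Ψ w ++ [ x ]                      ≡⟨ cong (x ∷_) (++-assoc (ψ w) [ x ] [ x ]) ⟩
      x ∷ ψ w ++ x ∷ x ∷ []                 ≡⟨ cong₂ (λ p r → p ++ ψ w ++ r ++ [ x ]) block-s block-s ⟨
      block x ++ ψ w ++ block x ++ [ x ]    ≡⟨ Ψ-sandwich x w x ⟨
      Ψ (x ∷ w ++ [ x ])                    ∎) f
    by-cases (no x≢s)
      with y , fy ← extendˡ (prefix [ x ] f) f
      with separates (prefix (y ∷ x ∷ []) fy)
    ... | inj₂ x≡s  = ⊥-elim (x≢s x≡s)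
    ... | inj₁ refl
      with z , fz ← extendʳ (prefix [ x ] f) fy
      with separates (suffix (s ∷ x ∷ Ψ w) (subst Fac (cong (λ r → s ∷ x ∷ r) (++-assoc (Ψ w) [ x ] [ z ])) fz))
    ...   | inj₁ x≡s  = ⊥-elim (x≢s x≡s)
    ...   | inj₂ refl = subst Fac (begin
      s ∷ x ∷ (Ψ w ++ [ x ]) ++ [ s ]       ≡⟨ cong (λ r → s ∷ x ∷ r) (++-assoc (Ψ w) [ x ] [ s ]) ⟩
      s ∷ x ∷ Ψ w ++ x ∷ s ∷ []             ≡⟨ cong (λ r → s ∷ x ∷ r) (++-assoc (ψ w) [ s ] (x ∷ s ∷ [])) ⟩
      s ∷ x ∷ ψ w ++ s ∷ x ∷ s ∷ []         ≡⟨ cong₂ (λ p r → p ++ ψ w ++ r ++ [ s ]) (block-≢ x≢s) (block-≢ x≢s) ⟨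
      block x ++ ψ w ++ block x ++ [ s ]    ≡⟨ Ψ-sandwich x w x ⟨
      Ψ (x ∷ w ++ [ x ])                    ∎) fz

-- The descent on palindromes with an isolated letter

module _ (𝓛 : Language) (s : Letter) (q : Word) where
  open Language 𝓛

  -- A letter other than `s` is not comparable with `s ∷ q`, so it is not left special and has at
  -- most one predecessor. If `x y` avoided `s`, then by reversal `x` and `y` would only be preceded
  -- by each other, and `y` could never be reached from `s`.
  head-separates : (∀ {w} → LeftSpecialIn w → w ≼ (s ∷ q) ⊎ (s ∷ q) ≼ w) → Fac [ s ] →
    ∀ {x y} → Fac (x ∷ y ∷ []) → x ≡ s ⊎ y ≡ s
  head-separates comparable fs {x} {y} f with x ≟ s | y ≟ s
  ... | yes x≡s | _       = inj₁ x≡s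
  ... | no  _   | yes y≡s = inj₂ y≡s
  ... | no  x≢s | no  y≢s with v , f′ ← recurrent fs (suffix [ x ] f) =
    ⊥-elim ([ x≢s ∘ sym , y≢s ∘ sym ]′
      (predecessor-closed (λ z → z ≡ x ⊎ z ≡ y) closed s v f′ (inj₂ refl)))
    where
    unique : ∀ {a b z} → z ≢ s → Fac (a ∷ z ∷ []) → Fac (b ∷ z ∷ []) → a ≡ b
    unique {a} {b} z≢s fa fb with a ≟ b
    ... | yes a≡b = a≡b
    ... | no  a≢b with comparable (a , b , a≢b , fa , fb)
    ...   | inj₁ (_ , e) = ⊥-elim (z≢s (∷-injectiveˡ e))
    ...   | inj₂ (_ , e) = ⊥-elim (z≢s (sym (∷-injectiveˡ e)))

    closed : ∀ {w z} → Fac (w ∷ z ∷ []) → z ≡ x ⊎ z ≡ y → w ≡ x ⊎ w ≡ y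
    closed g (inj₁ refl) = inj₂ (unique x≢s g (reversal f))
    closed g (inj₂ refl) = inj₁ (unique y≢s g f)

-- Induction on a bound `n` for the length of `p`. For nonempty `p` every hypothesis is transported
-- to the preimage of `p` under `Ψ`, with the letters `c` and `a` unchanged.
no-isolated-letter : ∀ n (𝓛 : Language) → let open Language 𝓛 in
  ∀ p → length p ≤ n → Palindrome p →
  (∀ {w} → LeftSpecialIn w → w ≼ p ⊎ p ≼ w) →
  (∀ x → Fac (x ∷ p ++ [ x ])) →
  ∀ c a → a ≢ c → ¬ (∀ x → x ≢ c → ¬ Fac (c ∷ p ++ [ x ]))
no-isolated-letter n 𝓛 [] _ _ _ diagonal c a a≢c isolated
  with v , f ← Language.recurrent 𝓛 (Language.prefix 𝓛 [ a ] (diagonal a)) (Language.prefix 𝓛 [ c ] (diagonal c)) =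
  a≢c (predecessor-closed (_≡ c) (λ { {x} g refl → closed x g }) a v f refl)
  where
  open Language 𝓛
  closed : ∀ x → Fac (x ∷ c ∷ []) → x ≡ c
  closed x g with x ≟ c
  ... | yes x≡c = x≡c
  ... | no  x≢c = ⊥-elim (isolated x x≢c (reversal g))
no-isolated-letter (suc n) 𝓛 p@(s ∷ q) (s≤s q≤n) pal comparable diagonal c a a≢c isolated = conclude (decode-palindrome pal fp)
  where
  open Language 𝓛
  open Substitution s

  fp : Fac p
  fp = factorial [ s ] p [ s ] (diagonal s)

  open Desubstitution 𝓛 s (head-separates 𝓛 s q comparable (prefix [ s ] fp))

  conclude : ¬ (∃ λ t → p ≡ Ψ t)
  conclude (t , p≡) = no-isolated-letter n desubstituted t t≤n pal′ comparable′ diagonal′ c a a≢c isolated′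
    where
    t≤n : length t ≤ n
    t≤n = ℕₚ.≤-trans (length-ψ t) (ℕₚ.≤-trans (ℕₚ.≤-reflexive (ℕₚ.suc-injective
      (trans (sym (trans (length-++ (ψ t)) (ℕₚ.+-comm _ 1))) (cong length (sym p≡))))) q≤n)

    pal′ : Palindrome t
    pal′ = Ψ-injective (reverse t) t
      (trans (sym (reverse-Ψ t)) (trans (cong reverse (sym p≡)) (trans pal p≡)))

    comparable′ : ∀ {w} → Language.LeftSpecialIn desubstituted w → w ≼ t ⊎ t ≼ w
    -- If `w` is left special after desubstitution, then `Ψ w` is left special in `𝓛`, hence
    -- comparable with `Ψ t`; `Ψ-prefix` brings the comparison back.
    comparable′ {w} (x , y , x≢y , fx , fy) with comparable (x , y , x≢y , unblock x w fx , unblock y w fy)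
    ... | inj₁ (r , e) = inj₁ (Ψ-prefix w t (r , trans e p≡))
    ... | inj₂ (r , e) = inj₂ (Ψ-prefix t w (r , trans (cong (_++ r) (sym p≡)) e))

    diagonal′ : ∀ x → Language.Fac desubstituted (x ∷ t ++ [ x ])
    diagonal′ x = block² x t (subst (λ v → Fac (x ∷ v ++ [ x ])) p≡ (diagonal x))

    isolated′ : ∀ x → x ≢ c → ¬ Language.Fac desubstituted (c ∷ t ++ [ x ])
    isolated′ x x≢c f = isolated x x≢c (subst (λ v → Fac (c ∷ v ++ [ x ])) (sym p≡) (unblock² c t x f))

-- Symmetric relations on three letters with five elements

allBool? : {P : Bool → Set} → Decidable P → Dec (∀ b → P b)
allBool? P? = map′ (λ { (t , f) true → t ; (t , f) false → f }) (λ h → h true , h false) (P? true ×-dec P? false)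

symmetric : (d₀ d₁ d₂ e₀₁ e₀₂ e₁₂ : Bool) → Letter → Letter → Bool
symmetric d₀ d₁ d₂ e₀₁ e₀₂ e₁₂ 0F 0F = d₀
symmetric d₀ d₁ d₂ e₀₁ e₀₂ e₁₂ 1F 1F = d₁
symmetric d₀ d₁ d₂ e₀₁ e₀₂ e₁₂ 2F 2F = d₂
symmetric d₀ d₁ d₂ e₀₁ e₀₂ e₁₂ 0F 1F = e₀₁
symmetric d₀ d₁ d₂ e₀₁ e₀₂ e₁₂ 1F 0F = e₀₁
symmetric d₀ d₁ d₂ e₀₁ e₀₂ e₁₂ 0F 2F = e₀₂
symmetric d₀ d₁ d₂ e₀₁ e₀₂ e₁₂ 2F 0F = e₀₂
symmetric d₀ d₁ d₂ e₀₁ e₀₂ e₁₂ 1F 2F = e₁₂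
symmetric d₀ d₁ d₂ e₀₁ e₀₂ e₁₂ 2F 1F = e₁₂

table : (f₀ f₁ f₂ : Letter) → Letter → Letter
table f₀ f₁ f₂ 0F = f₀
table f₀ f₁ f₂ 1F = f₁
table f₀ f₁ f₂ 2F = f₂

-- In the application `m x y` records whether `x p y` is a factor and `f y` is the primary left
-- extension of `p y`, so secondary pairs are the extra extensions.
module _ (m : Letter → Letter → Bool) (f : Letter → Letter) where

  Secondary : Letter × Letter → Set
  Secondary (x , y) = m x y ≡ true × x ≢ f y

  secondary? : Decidable Secondary
  secondary? (x , y) = m x y Bool.≟ true ×-dec ¬? (x ≟ f y)

  secondary : List (Letter × Letter)
  secondary = filter secondary? (cartesianProduct (allFin 3) (allFin 3))

  OneLoop : Set
  OneLoop = ∃ λ a → m a a ≡ true × (∀ b → m b b ≡ true → b ≡ a)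

  IsolatedLoop : Set
  IsolatedLoop = (∀ x → m x x ≡ true) × (∃ λ c → ∀ x → x ≢ c → m c x ≢ true)

  Dichotomy : Set
  Dichotomy = (∀ y → m (f y) y ≡ true) → length secondary ≡ 2 → OneLoop ⊎ IsolatedLoop

  dichotomy? : Dec Dichotomy
  dichotomy? =
    all? (λ y → m (f y) y Bool.≟ true) →-dec
    length secondary ℕ.≟ 2 →-dec
    (any? (λ a → m a a Bool.≟ true ×-dec all? (λ b → m b b Bool.≟ true →-dec b ≟ a)) ⊎-dec
     (all? (λ x → m x x Bool.≟ true) ×-dec
      any? (λ c → all? λ x → ¬? (x ≟ c) →-dec ¬? (m c x Bool.≟ true))))

abstract
  -- One chosen entry per column and two secondary ones make five. Off-diagonal entries come in
  -- pairs, so one or three lie on the diagonal; with three, a single off-diagonal pair remains and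
  -- misses one letter. Six Booleans and three letters encode all instances, and the finite search
  -- checks them.
  dichotomy : ∀ d₀ d₁ d₂ e₀₁ e₀₂ e₁₂ f₀ f₁ f₂ →
    Dichotomy (symmetric d₀ d₁ d₂ e₀₁ e₀₂ e₁₂) (table f₀ f₁ f₂)
  dichotomy = from-yes
    (allBool? λ d₀ → allBool? λ d₁ → allBool? λ d₂ → allBool? λ e₀₁ → allBool? λ e₀₂ → allBool? λ e₁₂ →
     all? λ f₀ → all? λ f₁ → all? λ f₂ →
     dichotomy? (symmetric d₀ d₁ d₂ e₀₁ e₀₂ e₁₂) (table f₀ f₁ f₂))

-- Counting in small lists

two-of-three : (x y z w : Letter) → x ≢ y → x ≢ w → y ≢ w → z ≢ w → z ≡ x ⊎ z ≡ y
two-of-three = from-yes (all? λ (x : Letter) → all? λ y → all? λ z → all? λ w →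
  ¬? (x ≟ y) →-dec ¬? (x ≟ w) →-dec ¬? (y ≟ w) →-dec ¬? (z ≟ w) →-dec (z ≟ x ⊎-dec z ≟ y))

unique-length : {A : Set} {xs ys : List A} → Unique xs → Unique ys →
  (∀ {x} → x ∈ xs → x ∈ ys) → (∀ {x} → x ∈ ys → x ∈ xs) → length xs ≡ length ys
unique-length ux uy to from = ↭-length (∼bag⇒↭ (unique∧set⇒bag ux uy (mk⇔ to from)))

pair-exhausted : {A : Set} {xs : List A} {x y z : A} → length xs ≡ 2 →
  x ∈ xs → y ∈ xs → x ≢ y → z ∈ xs → z ≡ x ⊎ z ≡ y
pair-exhausted {xs = _ ∷ _ ∷ []} _ (here refl)         _                   _   (here refl)         = inj₁ refl
pair-exhausted {xs = _ ∷ _ ∷ []} _ (there (here refl)) _                   _   (there (here refl)) = inj₁ refl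
pair-exhausted {xs = _ ∷ _ ∷ []} _ _                   (here refl)         _   (here refl)         = inj₂ refl
pair-exhausted {xs = _ ∷ _ ∷ []} _ _                   (there (here refl)) _   (there (here refl)) = inj₂ refl
pair-exhausted {xs = _ ∷ _ ∷ []} _ (here refl)         (here refl)         x≢y (there (here refl)) = ⊥-elim (x≢y refl)
pair-exhausted {xs = _ ∷ _ ∷ []} _ (there (here refl)) (there (here refl)) x≢y (here refl)         = ⊥-elim (x≢y refl)

two-others : (f : Letter) → ∃ λ x → ∃ λ y → x ≢ y × x ≢ f × y ≢ f
two-others 0F = 1F , 2F , (λ ()) , (λ ()) , (λ ())
two-others 1F = 0F , 2F , (λ ()) , (λ ()) , (λ ())
two-others 2F = 0F , 1F , (λ ()) , (λ ()) , (λ ())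

snoc : ∀ {A : Set} (w : List A) {n} → length w ≡ suc n → ∃ λ q → ∃ λ y → w ≡ q ++ [ y ] × length q ≡ n
snoc w l with initLast w
... | q ∷ʳ′ y = q , y , refl , ℕₚ.suc-injective (trans (sym (trans (length-++ q) (ℕₚ.+-comm (length q) 1))) l)

-- Factors of an infinite word and recurrence from closure under reversal

module _ (u : InfWord) where

  OccursAt : ℕ → Word → Set
  OccursAt i w = slice u i (length w) ≡ w

  slice-suc : ∀ i n → slice u i (suc n) ≡ u i ∷ slice u (suc i) n
  slice-suc i n = cong₂ _∷_ (cong u (ℕₚ.+-identityʳ i)) (tabulate-cong (λ j → cong u (ℕₚ.+-suc i (toℕ j))))

  slice-+ : ∀ m i n → slice u i (m + n) ≡ slice u i m ++ slice u (i + m) n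
  slice-+ zero    i n = tabulate-cong (λ j → cong (λ k → u (k + toℕ j)) (sym (ℕₚ.+-identityʳ i)))
  slice-+ (suc m) i n = begin
    slice u i (suc m + n)                                       ≡⟨ slice-suc i (m + n) ⟩
    u i ∷ slice u (suc i) (m + n)                               ≡⟨ cong (u i ∷_) (slice-+ m (suc i) n) ⟩
    u i ∷ slice u (suc i) m ++ slice u (suc i + m) n            ≡⟨ cong₂ _++_ (slice-suc i m) (cong (λ k → slice u k n) (ℕₚ.+-suc i m)) ⟨
    slice u i (suc m) ++ slice u (i + suc m) n                  ∎
    where open ≡-Reasoning

  length-slice : ∀ i n → length (slice u i n) ≡ n
  length-slice i n = length-tabulate _

  slice-occurs : ∀ i n → OccursAt i (slice u i n)
  slice-occurs i n = cong (slice u i) (length-slice i n)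

  occurs-∷ : ∀ {i x w} → OccursAt i (x ∷ w) → u i ≡ x × OccursAt (suc i) w
  occurs-∷ {i} {x} {w} o = ∷-injective (trans (sym (slice-suc i (length w))) o)

  occurs-++ˡ : ∀ w {i y} → OccursAt i (w ++ y) → OccursAt i w
  occurs-++ˡ []      o = refl
  occurs-++ˡ (x ∷ w) {i} o with refl , o′ ← occurs-∷ o =
    trans (slice-suc i (length w)) (cong (u i ∷_) (occurs-++ˡ w o′))

  occurs-++ʳ : ∀ x {i w} → OccursAt i (x ++ w) → OccursAt (i + length x) w
  occurs-++ʳ []      {i} {w} o = subst (λ k → OccursAt k w) (sym (ℕₚ.+-identityʳ i)) o
  occurs-++ʳ (_ ∷ x) {i} {w} o =
    subst (λ k → OccursAt k w) (sym (ℕₚ.+-suc i (length x))) (occurs-++ʳ x (proj₂ (occurs-∷ o)))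

  module _ (closed : ClosedUnderReversal u) where

    -- A prefix of u extending N letters beyond an occurrence of w is, reversed, again a factor,
    -- and there the reversal of w is preceded by N letters.
    late-reversal : ∀ {w} → Factor u w → ∀ N → ∃ λ i → OccursAt (i + N) (reverse w)
    late-reversal {w} (k , o) N = conclude (closed z (0 , slice-occurs 0 (k + (length w + N))))
      where
      open ≡-Reasoning
      α = slice u 0 k
      β = slice u (k + length w) N
      z = slice u 0 (k + (length w + N))

      reverse-z : reverse z ≡ reverse β ++ reverse w ++ reverse α
      reverse-z = begin
        reverse z                                     ≡⟨ cong reverse (slice-+ k 0 (length w + N)) ⟩
        reverse (α ++ slice u k (length w + N))       ≡⟨ cong (λ v → reverse (α ++ v)) (trans (slice-+ (length w) k N) (cong (_++ β) o)) ⟩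
        reverse (α ++ w ++ β)                         ≡⟨ reverse-++ α (w ++ β) ⟩
        reverse (w ++ β) ++ reverse α                 ≡⟨ cong (_++ reverse α) (reverse-++ w β) ⟩
        (reverse β ++ reverse w) ++ reverse α         ≡⟨ ++-assoc (reverse β) (reverse w) (reverse α) ⟩
        reverse β ++ reverse w ++ reverse α           ∎

      conclude : Factor u (reverse z) → ∃ λ i → OccursAt (i + N) (reverse w)
      conclude (i , o′) = i , subst (λ n → OccursAt (i + n) (reverse w))
        (trans (length-reverse β) (length-slice _ N))
        (occurs-++ˡ (reverse w) (occurs-++ʳ (reverse β) (subst (OccursAt i) reverse-z o′)))

    late : ∀ {w} → Factor u w → ∀ N → ∃ λ i → OccursAt (i + N) w
    late {w} f N with i , o ← late-reversal (closed w f) N = i , subst (OccursAt (i + N)) (reverse-involutive w) o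

    language : Language
    language = record
      { Fac       = Factor u
      ; factorial = λ { x w y (i , o) → i + length x , occurs-++ˡ w (occurs-++ʳ x o) }
      ; recurrent = recurrent
      ; reversal  = λ {w} → closed w
      }
      where
      recurrent : ∀ {x y} → Factor u x → Factor u y → ∃ λ v → Factor u (x ++ v ++ y)
      -- The occurrence of `x` ends just before `k + length x`, so the `y` found starts at or after
      -- that position, and `l` is the length of the gap.
      recurrent {x} {y} (k , ox) fy with l , oy ← late fy (k + length x) =
        v , subst (Factor u) eq (k , slice-occurs k (length x + (l + length y)))
        where
        open ≡-Reasoning
        v = slice u (k + length x) l
        eq : slice u k (length x + (l + length y)) ≡ x ++ v ++ y
        eq = begin
          slice u k (length x + (l + length y))                     ≡⟨ slice-+ (length x) k (l + length y) ⟩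
          slice u k (length x) ++ slice u (k + length x) (l + length y)
            ≡⟨ cong₂ _++_ ox (slice-+ l (k + length x) (length y)) ⟩
          x ++ v ++ slice u (k + length x + l) (length y)
            ≡⟨ cong (λ i → x ++ v ++ slice u i (length y)) (ℕₚ.+-comm (k + length x) l) ⟩
          x ++ v ++ slice u (l + (k + length x)) (length y)         ≡⟨ cong (λ t → x ++ v ++ t) oy ⟩
          x ++ v ++ y                                               ∎

-- Counting left extensions

module Ternary (u : InfWord) (closed : ClosedUnderReversal u)
  (complexity : ∀ n → ComplexityIs u n (2 * n + 1))
  (extendable : ∀ w → ¬ MaximalLeftSpecial u w) where

  open Language (language u closed)

  infix 4 _∈?_
  _∈?_ : ∀ (w : Word) ws → Dec (w ∈ ws)
  _∈?_ = DecMembership._∈?_ (≡-dec _≟_)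

  -- The complexity hypothesis lists all factors of each length, which replaces a search through
  -- infinitely many positions.
  factor? : Decidable (Factor u)
  factor? w with ws , _ , _ , sound , complete ← complexity (length w) with w ∈? ws
  ... | yes w∈ws = yes (proj₁ (sound w w∈ws))
  ... | no  w∉ws = no λ f → w∉ws (complete w f refl)

  leftSpecial? : Decidable (LeftSpecial u)
  leftSpecial? w = any? λ a → any? λ b → ¬? (a ≟ b) ×-dec factor? (a ∷ w) ×-dec factor? (b ∷ w)

  some-letter : Factor u [ u 0 ]
  some-letter = 0 , refl

  -- Non-maximality only refutes the absence of an extension; decidability turns this into a letter.
  extend-leftSpecial : ∀ {w} → LeftSpecial u w → ∃ λ c → LeftSpecial u (w ++ [ c ])
  extend-leftSpecial {w} ls = decidable-stable (any? λ c → leftSpecial? (w ++ [ c ]))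
    λ none → extendable w (ls , λ c lsc → none (c , lsc))

  leftSpecial-prefix : ∀ w {t} → LeftSpecial u (w ++ t) → LeftSpecial u w
  leftSpecial-prefix w (a , b , a≢b , fa , fb) = a , b , a≢b , prefix (a ∷ w) fa , prefix (b ∷ w) fb

  -- The least left extension. For a factor, `2F` is right by elimination; for a word without left
  -- extension it is a default value.
  primary : Word → Letter
  primary w with factor? (0F ∷ w) | factor? (1F ∷ w)
  ... | yes _ | _     = 0F
  ... | no  _ | yes _ = 1F
  ... | no  _ | no  _ = 2F

  primary-factor : ∀ {w} → Factor u w → Factor u (primary w ∷ w)
  primary-factor {w} f with factor? (0F ∷ w) | factor? (1F ∷ w)
  ... | yes f₀ | _      = f₀
  ... | no  _  | yes f₁ = f₁
  ... | no ¬f₀ | no ¬f₁ with extendˡ some-letter f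
  ...   | 0F , f₀ = ⊥-elim (¬f₀ f₀)
  ...   | 1F , f₁ = ⊥-elim (¬f₁ f₁)
  ...   | 2F , f₂ = f₂

  Extra : Letter → Word → Set
  Extra x w = Factor u (x ∷ w) × x ≢ primary w

  leftSpecial⇒extra : ∀ {w} → LeftSpecial u w → ∃ λ x → Extra x w
  leftSpecial⇒extra {w} (a , b , a≢b , fa , fb) with a ≟ primary w
  ... | no  a≢ = a , fa , a≢
  ... | yes a≡ = b , fb , λ b≡ → a≢b (trans a≡ (sym b≡))

  extra⇒leftSpecial : ∀ {x w} → Extra x w → LeftSpecial u w
  extra⇒leftSpecial {x} {w} (f , x≢) = x , primary w , x≢ , f , primary-factor (suffix [ x ] f)

  -- Every factor of length n has one primary extension, so C(n+1) - C(n) = 2 counts the extra ones.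
  record Extras (n : ℕ) : Set where
    field
      words    : List Word
      unique   : Unique words
      two      : length words ≡ 2
      sound    : ∀ {v} → v ∈ words → ∃ λ x → ∃ λ w → v ≡ x ∷ w × length w ≡ n × Extra x w
      complete : ∀ {x w} → length w ≡ n → Extra x w → x ∷ w ∈ words

  IsExtra : Word → Set
  IsExtra v = ∃ λ x → ∃ λ w → v ≡ x ∷ w × x ≢ primary w

  isExtra? : Decidable IsExtra
  isExtra? []      = no λ { (_ , _ , () , _) }
  isExtra? (x ∷ w) with x ≟ primary w
  ... | yes x≡ = no λ { (_ , _ , refl , x≢) → x≢ x≡ }
  ... | no  x≢ = yes (x , w , refl , x≢)

  extras : ∀ n → Extras n
  extras n with ws , uws , lws , sws , cws ← complexity n
              | vs , uvs , lvs , svs , cvs ← complexity (suc n) = record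
    { words    = es
    ; unique   = Unique.filter⁺ isExtra? uvs
    ; two      = ℕₚ.+-cancelˡ-≡ (2 * n + 1) _ _ count
    ; sound    = es-sound
    ; complete = λ { {x} {w} l (f , x≢) → ∈-filter⁺ isExtra? (cvs (x ∷ w) f (cong suc l)) (x , w , refl , x≢) }
    }
    where
    es ps : List Word
    es = filter isExtra? vs
    ps = map (λ w → primary w ∷ w) ws

    es-sound : ∀ {v} → v ∈ es → ∃ λ x → ∃ λ w → v ≡ x ∷ w × length w ≡ n × Extra x w
    es-sound v∈es with v∈vs , x , w , refl , x≢ ← ∈-filter⁻ isExtra? {xs = vs} v∈es
                  with f , l ← svs _ v∈vs = x , w , refl , ℕₚ.suc-injective l , f , x≢

    from : ∀ {v} → v ∈ vs → v ∈ ps ++ es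
    from {[]}    v∈vs with () ← proj₂ (svs _ v∈vs)
    from {x ∷ w} v∈vs with x ≟ primary w | svs _ v∈vs
    ... | yes refl | f , l = ∈-++⁺ˡ (∈-map⁺ (λ w → primary w ∷ w) (cws w (suffix [ x ] f) (ℕₚ.suc-injective l)))
    ... | no  x≢   | _     = ∈-++⁺ʳ ps (∈-filter⁺ isExtra? v∈vs (x , w , refl , x≢))

    to : ∀ {v} → v ∈ ps ++ es → v ∈ vs
    to v∈ with ∈-++⁻ ps v∈
    ... | inj₂ v∈es = proj₁ (∈-filter⁻ isExtra? {xs = vs} v∈es)
    ... | inj₁ v∈ps with w , w∈ws , refl ← ∈-map⁻ (λ w → primary w ∷ w) v∈ps with f , l ← sws w w∈ws =
      cvs _ (primary-factor f) (cong suc l)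

    disjoint : ∀ {v} → ¬ (v ∈ ps × v ∈ es)
    disjoint (v∈ps , v∈es) with w , _ , refl ← ∈-map⁻ (λ w → primary w ∷ w) v∈ps
                           with _ , _ , refl , x≢ ← proj₂ (∈-filter⁻ isExtra? {xs = vs} v∈es) = x≢ refl

    open ≡-Reasoning
    -- `ps` has one word for each factor of length `n`, and `ps ++ es` lists the factors of length
    -- `suc n` without repetition.
    count : 2 * n + 1 + length es ≡ 2 * n + 1 + 2
    count = begin
      2 * n + 1 + length es     ≡⟨ cong (_+ length es) (trans (length-map _ ws) lws) ⟨
      length ps + length es     ≡⟨ length-++ ps ⟨
      length (ps ++ es)         ≡⟨ unique-length (Unique.++⁺ (Unique.map⁺ ∷-injectiveʳ uws) (Unique.filter⁺ isExtra? uvs) disjoint) uvs to from ⟩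
      length vs                 ≡⟨ lvs ⟩
      2 * suc n + 1             ≡⟨ cong (_+ 1) (ℕₚ.*-suc 2 n) ⟩
      2 + 2 * n + 1             ≡⟨ ℕₚ.+-assoc 2 (2 * n) 1 ⟩
      2 + (2 * n + 1)           ≡⟨ ℕₚ.+-comm 2 (2 * n + 1) ⟩
      2 * n + 1 + 2             ∎

  extra-exhausted : ∀ {x y z v w t} → length w ≡ length v → length t ≡ length v →
    Extra x v → Extra y w → x ∷ v ≢ y ∷ w → Extra z t → z ∷ t ≡ x ∷ v ⊎ z ∷ t ≡ y ∷ w
  extra-exhausted {v = v} lw lt ev ew v≢w et =
    pair-exhausted two (complete refl ev) (complete lw ew) v≢w (complete lt et)
    where open Extras (extras (length v))

  -- The two non-primary extensions of `p` exhaust the extras of this length, and every left special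
  -- word has an extra.
  full⇒only-leftSpecial : ∀ {p} → (∀ x → Factor u (x ∷ p)) →
    ∀ {q} → length q ≡ length p → LeftSpecial u q → q ≡ p
  full⇒only-leftSpecial {p} full l ls
    with x , y , x≢y , x≢ , y≢ ← two-others (primary p) | z , e ← leftSpecial⇒extra ls
    = [ ∷-injectiveʳ , ∷-injectiveʳ ]′
        (extra-exhausted refl l (full x , x≢) (full y , y≢) (x≢y ∘ ∷-injectiveˡ) e)

  -- Both extras of this length then extend `p`; together with the primary extension they give three
  -- distinct letters, leaving no room for a missing `z`.
  only-leftSpecial⇒full : ∀ {p} → (∀ {q} → length q ≡ length p → LeftSpecial u q → q ≡ p) →
    ∀ z → Factor u (z ∷ p)
  only-leftSpecial⇒full {p} only z = decidable-stable (factor? (z ∷ p)) λ ¬fz →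
    absurd ¬fz words unique two sound
    where
    open Extras (extras (length p))
    absurd : ¬ Factor u (z ∷ p) → ∀ es → Unique es → length es ≡ 2 →
      (∀ {v} → v ∈ es → ∃ λ x → ∃ λ w → v ≡ x ∷ w × length w ≡ length p × Extra x w) → ⊥
    absurd ¬fz (_ ∷ _ ∷ []) ((v≢w ∷ _) ∷ _) refl sound
      with x , v , refl , lv , ex ← sound (here refl) | y , w , refl , lw , ey ← sound (there (here refl))
      with refl ← only lv (extra⇒leftSpecial ex) | refl ← only lw (extra⇒leftSpecial ey)
      = [ (λ e → proj₂ ex (sym e)) , (λ e → proj₂ ey (sym e)) ]′
          (two-of-three x y (primary p) z (v≢w ∘ cong (_∷ p)) (≢z (proj₁ ex)) (≢z (proj₁ ey))
            (≢z (primary-factor (suffix [ x ] (proj₁ ex)))))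
      where
      ≢z : ∀ {t} → Factor u (t ∷ p) → t ≢ z
      ≢z f refl = ¬fz f

  -- Palindromes with one, two or three left extensions

  module _ {p : Word} (fp : Factor u p) (pal : Palindrome p) where

    mirror : ∀ {x y} → Factor u (x ∷ p ++ [ y ]) → Factor u (y ∷ p ++ [ x ])
    mirror {x} {y} f = subst (Factor u) eq (reversal f)
      where
      eq : reverse (x ∷ p ++ [ y ]) ≡ y ∷ p ++ [ x ]
      eq = trans (unfold-reverse x (p ++ [ y ])) (cong (_++ [ x ])
             (trans (reverse-++ p [ y ]) (cong (y ∷_) pal)))

    left : ∀ {x y} → Factor u (x ∷ p ++ [ y ]) → Factor u (x ∷ p)
    left {x} = prefix (x ∷ p)

    UniqueExtension : Set
    UniqueExtension = ∃ λ a → Factor u (a ∷ p ++ [ a ]) × (∀ b → Factor u (b ∷ p ++ [ b ]) → b ≡ a)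

    -- If `a` is the only left extension and `a p b` is a factor, then so is `b p a`, whence
    -- `b ≡ a`.
    not-leftSpecial : ¬ LeftSpecial u p → UniqueExtension
    not-leftSpecial ¬ls
      with a , fa ← extendˡ some-letter fp
      with b , fab ← extendʳ some-letter fa
      = a , subst (λ x → Factor u (a ∷ p ++ [ x ])) (unique (left (mirror fab)) fa) fab ,
        λ c fc → unique (left fc) fa
      where
      unique : ∀ {x y} → Factor u (x ∷ p) → Factor u (y ∷ p) → x ≡ y
      unique {x} {y} fx fy = decidable-stable (x ≟ y) λ x≢y → ¬ls (x , y , x≢y , fx , fy)

    -- Some `p c` is left special, so both left extensions of `p` also precede `p c`. By `mirror`,
    -- `c` is one of them, so `c p c` is a factor.
    binary : LeftSpecial u p → ∀ z → ¬ Factor u (z ∷ p) → UniqueExtension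
    binary ls z ¬fz with c , lsc@(x , y , x≢y , fx , fy) ← extend-leftSpecial ls =
      c , loop (left (mirror fx)) , only-c
      where
      ≢z : ∀ {t} → Factor u (t ∷ p) → t ≢ z
      ≢z f refl = ¬fz f

      loop : ∀ {t} → Factor u (t ∷ p) → Factor u (t ∷ p ++ [ c ])
      loop {t} ft with two-of-three x y t z x≢y (≢z (left fx)) (≢z (left fy)) (≢z ft)
      ... | inj₁ refl = fx
      ... | inj₂ refl = fy

      only-c : ∀ d → Factor u (d ∷ p ++ [ d ]) → d ≡ c
      only-c d fd = decidable-stable (d ≟ c) λ d≢c →
        -- A second loop `d` makes `p d` left special too. Then `p c` and `p d` use up the extras of
        -- their length; since left special words extend to the right, `p` is the only left special
        -- word of its length and has all three extensions.
        let lsd = d , c , d≢c , fd , mirror (loop (left fd))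
            e , ec = leftSpecial⇒extra lsc
            e′ , ed = leftSpecial⇒extra lsd
            same : ∀ t → length (p ++ [ t ]) ≡ length (p ++ [ c ])
            same t = trans (length-++ p) (sym (length-++ p))
            only : ∀ {q} → length q ≡ length p → LeftSpecial u q → q ≡ p
            only {q} l lsq = let t , lst = extend-leftSpecial lsq
                                 _ , et = leftSpecial⇒extra lst in
              [ ∷ʳ-injectiveˡ q p ∘ ∷-injectiveʳ , ∷ʳ-injectiveˡ q p ∘ ∷-injectiveʳ ]′
                (extra-exhausted (same d) (trans (length-++ q) (trans (cong (_+ 1) l) (sym (length-++ p)))) ec ed
                  (λ eq → d≢c (sym (∷ʳ-injectiveʳ p p (∷-injectiveʳ eq)))) et)
        in ¬fz (only-leftSpecial⇒full only z)

    module _ (full : ∀ x → Factor u (x ∷ p)) where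

      -- Prefixes of `p` keep three left extensions and prefixes of `w` stay left special; cut to
      -- the shorter length, the two words agree by `full⇒only-leftSpecial`.
      comparable : ∀ {w} → LeftSpecial u w → w ≼ p ⊎ p ≼ w
      comparable {w} ls with ℕₚ.≤-total (length w) (length p)
      ... | inj₁ w≤p = inj₁ (drop k p , trans (cong (_++ drop k p) w≡) (take++drop≡id k p))
        where
        k = length w
        full-take : ∀ x → Factor u (x ∷ take k p)
        full-take x = prefix (x ∷ take k p) (subst (λ v → Factor u (x ∷ v)) (sym (take++drop≡id k p)) (full x))
        w≡ : w ≡ take k p
        w≡ = full⇒only-leftSpecial full-take (sym (trans (length-take k p) (ℕₚ.m≤n⇒m⊓n≡m w≤p))) ls
      ... | inj₂ p≤w = inj₂ (drop k w , trans (cong (_++ drop k w) (sym p≡)) (take++drop≡id k w))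
        where
        k = length p
        p≡ : take k w ≡ p
        p≡ = full⇒only-leftSpecial full (trans (length-take k w) (ℕₚ.m≤n⇒m⊓n≡m p≤w))
               (leftSpecial-prefix (take k w) (subst (LeftSpecial u) (sym (take++drop≡id k w)) ls))

      -- Only the entries on and above the diagonal are tested, to match the form in `dichotomy`;
      -- `m-does` recovers the others by `mirror`.
      m : Letter → Letter → Bool
      m = symmetric (e 0F 0F) (e 1F 1F) (e 2F 2F) (e 0F 1F) (e 0F 2F) (e 1F 2F)
        where
        e : Letter → Letter → Bool
        e x y = does (factor? (x ∷ p ++ [ y ]))

      f : Letter → Letter
      f = table (primary (p ++ [ 0F ])) (primary (p ++ [ 1F ])) (primary (p ++ [ 2F ]))

      m-does : ∀ x y → m x y ≡ does (factor? (x ∷ p ++ [ y ]))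
      m-does 0F 0F = refl
      m-does 0F 1F = refl
      m-does 0F 2F = refl
      m-does 1F 0F = does-⇔ (mk⇔ mirror mirror) (factor? _) (factor? _)
      m-does 1F 1F = refl
      m-does 1F 2F = refl
      m-does 2F 0F = does-⇔ (mk⇔ mirror mirror) (factor? _) (factor? _)
      m-does 2F 1F = does-⇔ (mk⇔ mirror mirror) (factor? _) (factor? _)
      m-does 2F 2F = refl

      m-sound : ∀ {x y} → m x y ≡ true → Factor u (x ∷ p ++ [ y ])
      m-sound {x} {y} e with factor? (x ∷ p ++ [ y ]) | trans (sym (m-does x y)) e
      ... | yes fxy | _ = fxy

      m-complete : ∀ {x y} → Factor u (x ∷ p ++ [ y ]) → m x y ≡ true
      m-complete {x} {y} fxy = trans (m-does x y) (dec-true (factor? (x ∷ p ++ [ y ])) fxy)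

      f-primary : ∀ y → f y ≡ primary (p ++ [ y ])
      f-primary 0F = refl
      f-primary 1F = refl
      f-primary 2F = refl

      right : ∀ y → Factor u (p ++ [ y ])
      right y = subst (λ v → Factor u (v ++ [ y ])) pal (reversal-++ [ y ] (full y))

      f-column : ∀ y → m (f y) y ≡ true
      f-column y = m-complete (subst (λ x → Factor u (x ∷ p ++ [ y ])) (sym (f-primary y)) (primary-factor (right y)))

      around : Letter × Letter → Word
      around (x , y) = x ∷ p ++ [ y ]

      around-injective : ∀ {s t} → around s ≡ around t → s ≡ t
      around-injective e = cong₂ _,_ (∷-injectiveˡ e) (∷ʳ-injectiveʳ p p (∷-injectiveʳ e))

      -- `around` matches secondary pairs with the extras of the next length: an extra extends a
      -- left special word, whose prefix of length `length p` is left special and hence `p`.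
      two-secondary : length (secondary m f) ≡ 2
      two-secondary = trans (sym (length-map around (secondary m f)))
        (trans (unique-length (Unique.map⁺ around-injective (Unique.filter⁺ (secondary? m f)
                 (Unique.cartesianProduct⁺ (Unique.allFin⁺ 3) (Unique.allFin⁺ 3)))) unique to from) two)
        where
        open Extras (extras (suc (length p)))

        length-∷ʳ : ∀ y → length (p ++ [ y ]) ≡ suc (length p)
        length-∷ʳ y = trans (length-++ p) (ℕₚ.+-comm (length p) 1)

        to : ∀ {v} → v ∈ map around (secondary m f) → v ∈ words
        to v∈ with (x , y) , xy∈ , refl ← ∈-map⁻ around v∈
              with _ , mxy , x≢ ← ∈-filter⁻ (secondary? m f) {xs = cartesianProduct (allFin 3) (allFin 3)} xy∈
          = complete (length-∷ʳ y) (m-sound mxy , λ x≡ → x≢ (trans x≡ (sym (f-primary y))))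

        from : ∀ {v} → v ∈ words → v ∈ map around (secondary m f)
        from v∈ with x , w , refl , l , ex ← sound v∈ with snoc w l
        ... | q , y , refl , lq with full⇒only-leftSpecial full lq (leftSpecial-prefix q (extra⇒leftSpecial ex))
        ...   | refl = ∈-map⁺ around (∈-filter⁺ (secondary? m f)
            (∈-cartesianProduct⁺ (∈-allFin x) (∈-allFin y))
            (m-complete (proj₁ ex) , λ x≡ → proj₂ ex (trans x≡ (f-primary y))))

      ternary : UniqueExtension
      ternary = [ one , isolated ]′ (dichotomy _ _ _ _ _ _ _ _ _ f-column two-secondary)
        where
        one : OneLoop m f → UniqueExtension
        one (a , ma , only-a) = a , m-sound ma , λ b fb → only-a b (m-complete fb)
        isolated : IsolatedLoop m f → UniqueExtension
        isolated (loops , c , alone) with a , _ , _ , a≢c , _ ← two-others c =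
          ⊥-elim (no-isolated-letter (length p) (language u closed) p ℕₚ.≤-refl pal comparable
            (λ x → m-sound (loops x)) c a a≢c (λ x x≢c → alone x x≢c ∘ m-complete))

  palindrome-extension : PE u
  palindrome-extension p fp pal with leftSpecial? p
  ... | no ¬ls = not-leftSpecial fp pal ¬ls
  ... | yes ls with all? (λ x → factor? (x ∷ p))
  ...   | yes full = ternary fp pal full
  ...   | no ¬full with z , ¬fz ← ¬∀⟶∃¬ 3 _ (λ x → factor? (x ∷ p)) ¬full = binary fp pal ls z ¬fz

theorem2 : (u : InfWord) → ClosedUnderReversal u →
    (∀ (n : ℕ) → ComplexityIs u n (2 * n + 1)) →
    (∀ w → ¬ MaximalLeftSpecial u w) →
    PE u
theorem2 = Ternary.palindrome-extension
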